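{- For all $k \ge 2$ and $n \ge 6$, \[ w(n,k) = w(n-1,k-1) + w(n-2,k), \] where $w(m,j)$ is the number of compositions of $m$ with all parts in $\{1,2\}$ having exactly $j$ water cells.
   Context: A composition of $n \ge 0$ is a finite sequence $(c_1,\dots,c_t)$ of positive integers with $c_1+\cdots+c_t=n$; the empty composition is the unique composition of $0$. Let $C_{12}(n)$ be the set of compositions of $n$ all of whose parts lie in $\{1,2\}$. The number of water cells of a composition $(c_1,\dots,c_t)$ is $\sum_{i=1}^{t} \max\bigl(0, \min(\max_{j \le i} c_j, \max_{j \ge i} c_j) - c_i\bigr)$ (the number of unit squares that would hold water poured over its bargraph, in which column $i$ has height $c_i$). For $n,k \ge 0$, $W(n,k)$ is the set of compositions in $C_{12}(n)$ with exactly $k$ water cells and $w(n,k)=|W(n,k)|$. -}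

module Defs where

open import Data.Empty using (⊥)
open import Data.Fin using (Fin; toℕ)
open import Data.List using (List; []; _∷_; _++_; map; filter; length; foldr; take; drop; lookup; allFin)
open import Data.List.Membership.Propositional using (_∈_)
open import Data.List.Membership.Propositional.Properties
  using (∈-map⁺; ∈-map⁻; ∈-++⁺ˡ; ∈-++⁺ʳ; ∈-++⁻; ∈-filter⁺; ∈-filter⁻)
open import Data.List.Properties using (∷-injectiveʳ)
open import Data.List.Relation.Unary.All using (All; []; _∷_)
open import Data.List.Relation.Unary.AllPairs using ([]; _∷_)
open import Data.List.Relation.Unary.Any using (here)
open import Data.List.Relation.Unary.Unique.Propositional using (Unique)
import Data.List.Relation.Unary.Unique.Propositional.Properties as Unique
open import Data.Nat using (ℕ; zero; suc; _+_; _∸_; _⊔_; _⊓_; _<_; _≟_; s≤s; z≤n)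
open import Data.Nat.ListAction using (sum)
open import Data.Nat.Properties using (suc-injective)
open import Data.Product using (_×_; _,_)
open import Data.Sum using (_⊎_; inj₁; inj₂)
open import Function using (_⇔_; mk⇔)
open import Relation.Binary.PropositionalEquality using (_≡_; refl; cong)

IsComposition : ℕ → List ℕ → Set
IsComposition n c = All (0 <_) c × sum c ≡ n

PartsIn12 : List ℕ → Set
PartsIn12 = All (λ p → p ≡ 1 ⊎ p ≡ 2)

-- The value 0 on [] is harmless: every list it is applied to below is nonempty.
maximum : List ℕ → ℕ
maximum = foldr _⊔_ 0

-- With 0-based i, the parts at positions ≤ i are take (suc i) c and those at
-- positions ≥ i are drop i c; truncated subtraction is max(0, a - b).
waterAt : (c : List ℕ) → Fin (length c) → ℕ
waterAt c i =
  (maximum (take (suc (toℕ i)) c) ⊓ maximum (drop (toℕ i) c)) ∸ lookup c i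

waterCells : List ℕ → ℕ
waterCells c = sum (map (waterAt c) (allFin (length c)))

-- Finite sets are represented by duplicate-free lists. That C12 and W list
-- exactly the intended compositions, once each, is ∈-C12, C12-unique, ∈-W
-- and W-unique below; hence length (W n k) is the cardinality.
C12 : ℕ → List (List ℕ)
C12 zero          = [] ∷ []
C12 (suc zero)    = (1 ∷ []) ∷ []
C12 (suc (suc n)) = map (1 ∷_) (C12 (suc n)) ++ map (2 ∷_) (C12 n)

W : ℕ → ℕ → List (List ℕ)
W n k = filter (λ c → waterCells c ≟ k) (C12 n)

w : ℕ → ℕ → ℕ
w n k = length (W n k)

private
  sound : ∀ n {c} → c ∈ C12 n → IsComposition n c × PartsIn12 c
  sound zero       (here refl) = ([] , refl) , []
  sound (suc zero) (here refl) = (s≤s z≤n ∷ [] , refl) , inj₁ refl ∷ []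
  sound (suc (suc n)) c∈ with ∈-++⁻ (map (1 ∷_) (C12 (suc n))) c∈
  ... | inj₁ c∈₁
    with d , d∈ , refl ← ∈-map⁻ (1 ∷_) c∈₁
    with (pos , eq) , parts ← sound (suc n) d∈ =
    (s≤s z≤n ∷ pos , cong suc eq) , inj₁ refl ∷ parts
  ... | inj₂ c∈₂
    with d , d∈ , refl ← ∈-map⁻ (2 ∷_) c∈₂
    with (pos , eq) , parts ← sound n d∈ =
    (s≤s z≤n ∷ pos , cong (2 +_) eq) , inj₂ refl ∷ parts

  complete : ∀ n {c} → sum c ≡ n → PartsIn12 c → c ∈ C12 n
  complete zero          {[]} refl [] = here refl
  complete zero          () (inj₁ refl ∷ _)
  complete zero          () (inj₂ refl ∷ _)
  complete (suc zero)    {_ ∷ c} eq (inj₁ refl ∷ parts)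
    with here refl ← complete zero (suc-injective eq) parts = here refl
  complete (suc zero)    () (inj₂ refl ∷ _)
  complete (suc (suc n)) eq (inj₁ refl ∷ parts) =
    ∈-++⁺ˡ (∈-map⁺ (1 ∷_) (complete (suc n) (suc-injective eq) parts))
  complete (suc (suc n)) eq (inj₂ refl ∷ parts) =
    ∈-++⁺ʳ (map (1 ∷_) (C12 (suc n)))
      (∈-map⁺ (2 ∷_) (complete n (suc-injective (suc-injective eq)) parts))

∈-C12 : ∀ {n c} → c ∈ C12 n ⇔ (IsComposition n c × PartsIn12 c)
∈-C12 {n} = mk⇔ (sound n) λ { ((_ , eq) , parts) → complete n eq parts }

C12-unique : ∀ n → Unique (C12 n)
C12-unique zero          = [] ∷ []
C12-unique (suc zero)    = [] ∷ []
C12-unique (suc (suc n)) =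
  Unique.++⁺ (Unique.map⁺ ∷-injectiveʳ (C12-unique (suc n)))
             (Unique.map⁺ ∷-injectiveʳ (C12-unique n))
             λ { (c∈₁ , c∈₂) → disjoint c∈₁ c∈₂ }
  where
  disjoint : ∀ {c} → c ∈ map (1 ∷_) (C12 (suc n)) → c ∈ map (2 ∷_) (C12 n) → ⊥
  disjoint c∈₁ c∈₂ with _ , _ , refl ← ∈-map⁻ (1 ∷_) c∈₁ with ∈-map⁻ (2 ∷_) c∈₂
  ... | _ , _ , ()

∈-W : ∀ {n k c} →
      c ∈ W n k ⇔ ((IsComposition n c × PartsIn12 c) × waterCells c ≡ k)
∈-W {n} {k} = mk⇔
  (λ c∈ → let c∈C , eq = ∈-filter⁻ water≟k {xs = C12 n} c∈ in sound n c∈C , eq)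
  (λ { (((_ , s) , parts) , eq) → ∈-filter⁺ water≟k (complete n s parts) eq })
  where
  water≟k = λ c → waterCells c ≟ k

W-unique : ∀ n k → Unique (W n k)
W-unique n k = Unique.filter⁺ (λ c → waterCells c ≟ k) (C12-unique n)

{-# OPTIONS --safe #-}
-- In a composition with parts in {1,2}, the water cells sit on the 1s lying
-- between the first and the last 2. Put a 2 in front of every composition of n
-- and let r(n,k) count the results with k water cells. Deleting the first
-- part of the original composition gives
-- w(n+2,k) = w(n+1,k) + r(n,k) and, for k ≥ 2, r(n+2,k) = r(n+1,k-1) + r(n,k);
-- the recurrence for w then follows by induction on n.
module Submission where

open import Defs
open import Algebra.Properties.CommutativeSemigroup using (interchange)
open import Data.Fin using (Fin; toℕ)
open import Data.List using (List; []; _∷_; _++_; map; filter; length; take; drop; lookup; tabulate)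
open import Data.List.Membership.Propositional using (_∈_)
open import Data.List.Properties using (map-tabulate; tabulate-cong; filter-++; filter-accept; filter-reject; length-++)
open import Data.List.Relation.Unary.All as All using (All; []; _∷_)
open import Data.List.Relation.Unary.Any using (here; there)
open import Data.Nat using (ℕ; zero; suc; _+_; _∸_; _⊔_; _⊓_; _≤_; _≟_; _≤?_; s≤s; z≤n)
open import Data.Nat.ListAction using (sum)
open import Data.Nat.Properties
open import Data.Product using (_×_; _,_; proj₂)
open import Data.Sum using (_⊎_; inj₁; inj₂)
open import Function using (_∘_; _⇔_; mk⇔; Equivalence)
open import Relation.Binary.PropositionalEquality using (_≡_; refl; sym; trans; cong; cong₂; module ≡-Reasoning)
open import Relation.Nullary using (yes; no; contradiction)

private
  variable
    A B : Set

count : (A → ℕ) → ℕ → List A → ℕ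
count f k xs = length (filter (λ x → f x ≟ k) xs)

count-++ : ∀ (f : A → ℕ) k xs ys → count f k (xs ++ ys) ≡ count f k xs + count f k ys
count-++ f k xs ys =
  trans (cong length (filter-++ (λ x → f x ≟ k) xs ys)) (length-++ (filter (λ x → f x ≟ k) xs))

-- The equivalence is asked only for members of `xs`, so that it may rest on facts about
-- compositions in `C12 n`, such as `PartsIn12`.
count-map : ∀ (f : A → ℕ) (g : B → ℕ) {j k} (h : A → B) xs →
             (∀ {x} → x ∈ xs → g (h x) ≡ k ⇔ f x ≡ j) →
             count g k (map h xs) ≡ count f j xs
count-map f g h [] eq = refl
count-map f g {j} {k} h (x ∷ xs) eq with f x ≟ j
... | yes p = begin
  count g k (h x ∷ map h xs)   ≡⟨ cong length (filter-accept (λ y → g y ≟ k) (Equivalence.from (eq (here refl)) p)) ⟩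
  suc (count g k (map h xs))   ≡⟨ cong suc (count-map f g h xs (eq ∘ there)) ⟩
  suc (count f j xs)           ≡⟨ cong length (filter-accept (λ y → f y ≟ j) p) ⟨
  count f j (x ∷ xs)           ∎
  where open ≡-Reasoning
... | no ¬p = begin
  count g k (h x ∷ map h xs)   ≡⟨ cong length (filter-reject (λ y → g y ≟ k) (¬p ∘ Equivalence.to (eq (here refl)))) ⟩
  count g k (map h xs)         ≡⟨ count-map f g h xs (eq ∘ there) ⟩
  count f j xs                 ≡⟨ cong length (filter-reject (λ y → f y ≟ j) ¬p) ⟨
  count f j (x ∷ xs)           ∎
  where open ≡-Reasoning

-- The water over c when a column of height m stands to its left, not counting
-- the water over that column.
waterBehind : ℕ → List ℕ → ℕ
waterBehind m []      = 0
waterBehind m (x ∷ c) =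
  ((m ⊔ x) ⊓ maximum (x ∷ c)) ∸ x + waterBehind (m ⊔ x) c

-- The wall `m` makes the induction possible: by associativity of `_⊔_`, the first part moves out of
-- each prefix maximum into the wall. At `m = 0` the sum is `waterCells c`.
sum-waterBehind : ∀ m c →
  sum (tabulate λ (i : Fin (length c)) →
        ((m ⊔ maximum (take (suc (toℕ i)) c)) ⊓ maximum (drop (toℕ i) c)) ∸ lookup c i)
  ≡ waterBehind m c
sum-waterBehind m []      = refl
sum-waterBehind m (x ∷ c) = cong₂ _+_
  (cong (λ y → ((m ⊔ y) ⊓ maximum (x ∷ c)) ∸ x) (⊔-identityʳ x))
  (trans
    (cong sum (tabulate-cong λ i →
      cong (λ y → (y ⊓ maximum (drop (toℕ i) c)) ∸ lookup c i)
        (sym (⊔-assoc m x (maximum (take (suc (toℕ i)) c))))))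
    (sum-waterBehind (m ⊔ x) c))

waterCells≡waterBehind : ∀ c → waterCells c ≡ waterBehind 0 c
waterCells≡waterBehind c =
  trans (cong sum (map-tabulate (λ i → i) (waterAt c))) (sum-waterBehind 0 c)

-- The wall enters only through `m ⊔ x`, and every first part is at least 1.
waterBehind-1 : ∀ {c} → PartsIn12 c → waterBehind 1 c ≡ waterBehind 0 c
waterBehind-1 []              = refl
waterBehind-1 (inj₁ refl ∷ _) = refl
waterBehind-1 (inj₂ refl ∷ _) = refl

waterCells-1∷ : ∀ {c} → PartsIn12 c → waterCells (1 ∷ c) ≡ waterCells c
waterCells-1∷ {c} parts = begin
  waterCells (1 ∷ c)                                ≡⟨ waterCells≡waterBehind (1 ∷ c) ⟩
  (1 ⊓ maximum (1 ∷ c)) ∸ 1 + waterBehind 1 c       ≡⟨ cong (_+ waterBehind 1 c) (m≤n⇒m∸n≡0 (m⊓n≤m 1 (maximum (1 ∷ c)))) ⟩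
  waterBehind 1 c                                   ≡⟨ waterBehind-1 parts ⟩
  waterBehind 0 c                                   ≡⟨ waterCells≡waterBehind c ⟨
  waterCells c                                      ∎
  where open ≡-Reasoning

waterBehind-2∷ : ∀ c → waterBehind 2 (2 ∷ c) ≡ waterBehind 2 c
waterBehind-2∷ c = cong (_+ waterBehind 2 c) (m≤n⇒m∸n≡0 (m⊓n≤m 2 (maximum (2 ∷ c))))

waterCells-2∷ : ∀ c → waterCells (2 ∷ c) ≡ waterBehind 2 c
waterCells-2∷ c = trans (waterCells≡waterBehind (2 ∷ c)) (waterBehind-2∷ c)

-- No water level exceeds the maximum to the right, which is at most `b`, and no column is below
-- `b`.
waterBehind-flat : ∀ m {b c} → All (b ≤_) c → maximum c ≤ b → waterBehind m c ≡ 0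
waterBehind-flat m [] _ = refl
waterBehind-flat m {b} {x ∷ c} (b≤x ∷ b≤c) max≤b = cong₂ _+_
  (m≤n⇒m∸n≡0 (≤-trans (m⊓n≤n (m ⊔ x) (maximum (x ∷ c))) (≤-trans max≤b b≤x)))
  (waterBehind-flat (m ⊔ x) b≤c (m⊔n≤o⇒n≤o x (maximum c) max≤b))

-- If `c` contains a 2, the new 1 lies between two columns of height 2 and gains one cell; otherwise
-- nothing on the right retains water.
waterBehind-1∷ : ∀ {c} → PartsIn12 c →
                 waterBehind 2 (1 ∷ c) ≡ suc (waterBehind 2 c) ⊎
                 (waterBehind 2 (1 ∷ c) ≡ 0 × waterBehind 2 c ≡ 0)
waterBehind-1∷ {c} parts with maximum c ≤? 1
... | yes max≤1 = inj₂
  ( waterBehind-flat 2 {1} (s≤s z≤n ∷ positive) (⊔-lub ≤-refl max≤1)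
  , waterBehind-flat 2 positive max≤1)
  where
  positive : All (1 ≤_) c
  positive = All.map (λ { (inj₁ refl) → s≤s z≤n ; (inj₂ refl) → s≤s z≤n }) parts
-- Here `maximum c` is at least 2, so the level over the 1 is exactly the wall height 2.
... | no max≰1 = inj₁ (cong (λ y → y ∸ 1 + waterBehind 2 c)
  (m≤n⇒m⊓n≡m (≤-trans (≰⇒> max≰1) (m≤n⊔m 1 (maximum c)))))

-- Both targets are positive, which excludes the case without a 2. This is the source of the
-- condition that `k` be at least 2 in the theorem.
waterBehind-1∷-⇔ : ∀ {c} k → PartsIn12 c →
                   waterBehind 2 (1 ∷ c) ≡ suc (suc k) ⇔ waterBehind 2 c ≡ suc k
waterBehind-1∷-⇔ k parts with waterBehind-1∷ parts
... | inj₁ eq        = mk⇔ (λ p → suc-injective (trans (sym eq) p)) (λ p → trans eq (cong suc p))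
... | inj₂ (eq , eq′) = mk⇔ (λ p → contradiction (trans (sym p) eq) λ ())
                            (λ p → contradiction (trans (sym p) eq′) λ ())

r : ℕ → ℕ → ℕ
r n k = count (waterBehind 2) k (C12 n)

∈-C12⇒PartsIn12 : ∀ n {c} → c ∈ C12 n → PartsIn12 c
∈-C12⇒PartsIn12 n = proj₂ ∘ Equivalence.to (∈-C12 {n})

≡-≡⇔ : ∀ {a b k : ℕ} → a ≡ b → a ≡ k ⇔ b ≡ k
≡-≡⇔ eq = mk⇔ (trans (sym eq)) (trans eq)

w-first-part : ∀ n k → w (2 + n) k ≡ w (1 + n) k + r n k
w-first-part n k =
  trans (count-++ waterCells k (map (1 ∷_) (C12 (suc n))) _) (cong₂ _+_
    (count-map waterCells waterCells (1 ∷_) (C12 (suc n))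
      (≡-≡⇔ ∘ waterCells-1∷ ∘ ∈-C12⇒PartsIn12 (suc n)))
    (count-map (waterBehind 2) waterCells (2 ∷_) (C12 n)
      λ {c} _ → ≡-≡⇔ (waterCells-2∷ c)))

r-first-part : ∀ n k → r (2 + n) (2 + k) ≡ r (1 + n) (1 + k) + r n (2 + k)
r-first-part n k =
  trans (count-++ (waterBehind 2) (2 + k) (map (1 ∷_) (C12 (suc n))) _) (cong₂ _+_
    (count-map (waterBehind 2) (waterBehind 2) (1 ∷_) (C12 (suc n))
      (waterBehind-1∷-⇔ k ∘ ∈-C12⇒PartsIn12 (suc n)))
    (count-map (waterBehind 2) (waterBehind 2) (2 ∷_) (C12 n)
      λ {c} _ → ≡-≡⇔ (waterBehind-2∷ c)))

w-recurrence : ∀ n k → w (2 + n) (2 + k) ≡ w (1 + n) (1 + k) + w n (2 + k)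
-- Compositions of numbers up to 3 hold no water, so in both base cases all the counts are 0.
w-recurrence zero          k = refl
w-recurrence (suc zero)    k = refl
w-recurrence (suc (suc n)) k = begin
  w (4 + n) (2 + k)
    ≡⟨ w-first-part (2 + n) (2 + k) ⟩
  w (3 + n) (2 + k) + r (2 + n) (2 + k)
    ≡⟨ cong₂ _+_ (w-recurrence (suc n) k) (r-first-part n k) ⟩
  (w (2 + n) (1 + k) + w (1 + n) (2 + k)) + (r (1 + n) (1 + k) + r n (2 + k))
    -- Regrouping pairs each `w` with the `r` that completes it in `w-first-part`, now read from
    -- right to left.
    ≡⟨ interchange +-commutativeSemigroup (w (2 + n) (1 + k)) (w (1 + n) (2 + k)) (r (1 + n) (1 + k)) (r n (2 + k)) ⟩
  (w (2 + n) (1 + k) + r (1 + n) (1 + k)) + (w (1 + n) (2 + k) + r n (2 + k))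
    ≡⟨ cong₂ _+_ (w-first-part (1 + n) (1 + k)) (w-first-part n (2 + k)) ⟨
  w (3 + n) (1 + k) + w (2 + n) (2 + k) ∎
  where open ≡-Reasoning

theorem2p4 : ∀ (n k : ℕ) → 6 ≤ n → 2 ≤ k →
    w n k ≡ w (n ∸ 1) (k ∸ 1) + w (n ∸ 2) k
theorem2p4 (suc (suc n)) (suc (suc k)) _ (s≤s (s≤s _)) = w-recurrence n k
theorem2p4 (suc zero) k (s≤s ()) _
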